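{- Let $\mathbb{F}$ be a field, let $s,t\in\mathbb{N}$ with $s,t\ge2$, and let $m,n\in\mathbb{N}$ with $n\ge s\cdot t^4$. Then any $m$-fold hyperplane section of $\mathrm{Gr}(n,2)$ either contains $\mathrm{Gr}(W,2)$ for some $s$-dimensional subspace $W\le\mathbb{F}^n$, or intersects $\mathrm{Gr}(W,2)$ trivially for some $t$-dimensional subspace $W\le\mathbb{F}^n$.
   Context: $\mathrm{Gr}(n,2)$ is the Grassmannian of $2$-dimensional subspaces of $\mathbb{F}^n$, and for a subspace $W\le\mathbb{F}^n$, $\mathrm{Gr}(W,2)\subseteq\mathrm{Gr}(n,2)$ is the subvariety of $2$-dimensional subspaces of $\mathbb{F}^n$ contained in $W$. An $m$-fold hyperplane section of $\mathrm{Gr}(n,2)$ is the section defined by an alternating bilinear map $\phi:\mathbb{F}^n\times\mathbb{F}^n\to\mathbb{F}^m$ (bilinear with $\phi(v,v)=0$ for all $v$), namely the set of all $V\in\mathrm{Gr}(n,2)$ such that $\phi(v_1,v_2)=0$ for all $v_1,v_2\in V$ (equivalently, the intersection of $\mathrm{Gr}(n,2)$ in its Plücker embedding with the zero loci of the $m$ linear forms given by the components of $\phi$). Two sets intersect trivially if their intersection is empty. -}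

module Defs where

open import Algebra.Bundles using (CommutativeRing)
open import Algebra.Module.Bundles.Raw using (RawLeftModule)
open import Algebra.Module.Morphism.Structures using (module LeftModuleMorphisms)
import Algebra.Properties.Semiring.Sum as SemiringSum
open import Data.Fin.Base using (Fin)
open import Data.Nat.Base using (ℕ)
open import Data.Product.Base using (∃-syntax; _×_)
open import Data.Vec.Functional using (Vector)
import Data.Vec.Functional.Relation.Binary.Equality.Setoid as VectorEquality
open import Level using (Level; _⊔_; suc)
open import Relation.Binary.Definitions using (_Respects_)
open import Relation.Nullary.Negation.Core using (¬_)
open import Relation.Unary using (Pred; _∈_; _⊆_)

-- The textbook (classical) notion of field.  The library's HeytingField carries
-- an extra apartness relation; under excluded middle that relation is
-- necessarily the negation of _≈_, and the two notions coincide.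
record Field c ℓ : Set (suc (c ⊔ ℓ)) where
  field
    commutativeRing : CommutativeRing c ℓ

  open CommutativeRing commutativeRing public

  field
    1≉0     : ¬ (1# ≈ 0#)
    inverse : ∀ x → ¬ (x ≈ 0#) → ∃[ y ] x * y ≈ 1#

module LinearAlgebra {c ℓ : Level} (F : Field c ℓ) where

  open Field F
  open SemiringSum semiring using (sum)
  open VectorEquality setoid using (_≋_) public

  F^ : ℕ → RawLeftModule Carrier c ℓ
  F^ n = record
    { Carrierᴹ = Vector Carrier n
    ; _≈ᴹ_     = _≋_
    ; _+ᴹ_     = λ u v i → u i + v i
    ; _*ₗ_     = λ a v i → a * v i
    ; 0ᴹ       = λ _ → 0#
    ; -ᴹ_      = λ v i → - v i
    }

  module _ {n : ℕ} where

    open RawLeftModule (F^ n)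

    linearCombination : ∀ {k} → Vector Carrier k → Vector Carrierᴹ k → Carrierᴹ
    linearCombination a w j = sum (λ i → a i * w i j)

    LinearlyIndependent : ∀ {k} → Vector Carrierᴹ k → Set (c ⊔ ℓ)
    LinearlyIndependent {k} w =
      ∀ (a : Vector Carrier k) → linearCombination a w ≈ᴹ 0ᴹ → ∀ i → a i ≈ 0#

  -- Membership lives in level c ⊔ ℓ, that of "being a linear combination of a
  -- given family", so every span of finitely many vectors is a Subspace.
  record Subspace (n : ℕ) : Set (suc (c ⊔ ℓ)) where
    open RawLeftModule (F^ n)
    field
      Member    : Pred Carrierᴹ (c ⊔ ℓ)
      respects  : Member Respects _≈ᴹ_
      0-closed  : 0ᴹ ∈ Member
      +-closed  : ∀ {u v} → u ∈ Member → v ∈ Member → u +ᴹ v ∈ Member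
      *ₗ-closed : ∀ a {v} → v ∈ Member → a *ₗ v ∈ Member

  open Subspace public using (Member)

  module _ {n : ℕ} where

    open RawLeftModule (F^ n)

    record IsBasis (W : Subspace n) {d : ℕ} (b : Vector Carrierᴹ d) : Set (c ⊔ ℓ) where
      field
        members     : ∀ i → b i ∈ Member W
        independent : LinearlyIndependent b
        spanning    : ∀ v → v ∈ Member W → ∃[ a ] v ≈ᴹ linearCombination a b

    HasDimension : Subspace n → ℕ → Set (c ⊔ ℓ)
    HasDimension W d = ∃[ b ] IsBasis W {d} b

  record AlternatingBilinearMap (n m : ℕ) : Set (c ⊔ ℓ) where
    open RawLeftModule (F^ n) using () renaming (Carrierᴹ to Fⁿ)
    open RawLeftModule (F^ m) using (_≈ᴹ_; 0ᴹ) renaming (Carrierᴹ to Fᵐ)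
    open LeftModuleMorphisms (F^ n) (F^ m) using (IsLeftModuleHomomorphism)
    field
      ⟦_,_⟧       : Fⁿ → Fⁿ → Fᵐ
      linearˡ     : ∀ v → IsLeftModuleHomomorphism (λ u → ⟦ u , v ⟧)
      linearʳ     : ∀ u → IsLeftModuleHomomorphism (λ v → ⟦ u , v ⟧)
      alternating : ∀ v → ⟦ v , v ⟧ ≈ᴹ 0ᴹ

  -- Sets of subspaces of Fⁿ are predicates on Subspace n.

  Gr : (n k : ℕ) → Pred (Subspace n) (c ⊔ ℓ)
  Gr n k V = HasDimension V k

  GrIn : ∀ {n} → Subspace n → (k : ℕ) → Pred (Subspace n) (c ⊔ ℓ)
  GrIn {n} W k V = V ∈ Gr n k × Member V ⊆ Member W

  hyperplaneSection : ∀ {n m} → AlternatingBilinearMap n m → Pred (Subspace n) (c ⊔ ℓ)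
  hyperplaneSection {n} {m} φ V =
    V ∈ Gr n 2 × (∀ v₁ v₂ → v₁ ∈ Member V → v₂ ∈ Member V → ⟦ v₁ , v₂ ⟧ ≈ᴹ 0ᴹ)
    where
    open AlternatingBilinearMap φ
    open RawLeftModule (F^ m)

{-# OPTIONS --safe #-}
module Submission where

-- Write t⁴ = D + 1.  Build vectors v₁, v₂, … together with decreasing subspaces Uᵢ
-- of codimension at most i t⁴: as long as some nonzero v ∈ Uᵢ pairs with Uᵢ with
-- rank at most D, cutting Uᵢ by v^⊥ and by a coordinate that is nonzero at v costs
-- at most t⁴ conditions.  If this succeeds s times, the vᵢ span an isotropic
-- subspace.  Otherwise it stops at some U ≠ 0 in which every nonzero x has rank
-- larger than D.  In such a U one finds w₁, …, w_t such that φ(x, wₖ), for nonzero x in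
-- the span of the wᵢ preceding wₖ, never lies in the span Sₖ of the earlier values
-- φ(wᵢ, wⱼ).  Then φ(Σ aᵢ wᵢ, Σ bⱼ wⱼ) = Σ_{i<j} (aᵢ bⱼ − aⱼ bᵢ) φ(wᵢ, wⱼ) vanishes only
-- if all minors do, so φ is nonzero on every plane in the span of the w's.
--
-- The vector u = wₖ is found by induction on the number of w's it has to be good
-- for.  If φ(x, u) ∈ Sₖ for a new x, perturb u by v ∈ U such that φ(x, v) ≠ 0 while
-- all φ(wᵢ, v) lie in a subspace meeting Sₖ + span φ(wᵢ, u) trivially.  This amounts
-- to at most D linear conditions on v, and the size of the field plays no role.

open import Defs
open import Axiom.ExcludedMiddle using (ExcludedMiddle)
open import Data.Nat using (ℕ; _*_; _^_; _≥_)
open import Data.Product using (_×_; ∃-syntax)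
open import Data.Sum using (_⊎_)
open import Level using (Level; _⊔_)
open import Relation.Unary using (_⊆_; _∩_; Empty)

import Algebra.Properties.Ring as RingProperties
import Algebra.Properties.Semiring.Sum as SemiringSum
open import Algebra.Module.Bundles.Raw using (RawLeftModule)
open import Algebra.Module.Morphism.Structures using (module LeftModuleMorphisms)
import Algebra.Solver.Ring.NaturalCoefficients.Default as SemiringSolver
open import Data.Fin using (Fin; zero; suc; _↑ˡ_; _↑ʳ_; punchIn; punchOut)
open import Data.Fin.Properties using (¬∀⟶∃¬; punchIn-punchOut) renaming (_≟_ to _≟ᶠ_)
open import Data.Nat as ℕ using (zero; suc; z≤n; s≤s)
import Data.Nat.Properties as ℕₚ
open import Data.Product using (_,_; proj₁; proj₂; Σ-syntax)
open import Data.Sum using (inj₁; inj₂)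
open import Data.Unit.Polymorphic using (⊤; tt)
open import Data.Vec.Functional using (Vector; []; _∷_; _++_; head; tail; map)
open import Data.Vec.Functional.Properties using (lookup-++ˡ; lookup-++ʳ)
open import Function using (_∘_)
open import Level using (Lift; lift; lower)
import Relation.Binary.Reasoning.Setoid as SetoidReasoning
import Relation.Binary.PropositionalEquality as ≡
open import Relation.Nullary using (¬_; Dec; yes; no; contradiction; decidable-stable)
open import Relation.Nullary.Decidable using (map′)

module ClassicalLinearAlgebra
  {c ℓ : Level} (em : ExcludedMiddle (c ⊔ ℓ)) (F : Field c ℓ) where

  open Field F hiding (zero) renaming (_*_ to infixl 7 _·_)
  open LinearAlgebra F
  open SemiringSum semiring using (sum-cong-≋; ∑-distrib-+; *-distribˡ-sum)
  open RingProperties ring using (-‿distribˡ-*; -‿distribʳ-*; +-inverseʳ-unique)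
  open SemiringSolver commutativeSemiring using (solve; _:+_; _:*_; _:=_)
  open module Vectors {n : ℕ} = RawLeftModule (F^ n) using (_+ᴹ_; _*ₗ_; 0ᴹ)

  private
    variable
      k l m n d d′ : ℕ

  -- Decidable equality and cancellation.

  V : ℕ → Set c
  V n = Vector Carrier n

  ≋-sym : {u v : V n} → u ≋ v → v ≋ u
  ≋-sym e i = sym (e i)

  ≋-trans : {u v w : V n} → u ≋ v → v ≋ w → u ≋ w
  ≋-trans e f i = trans (e i) (f i)

  -- Excluded middle is assumed at level `c ⊔ ℓ`, so equality, which lives at level `ℓ`, is lifted
  -- first.
  _≟_ : (x y : Carrier) → Dec (x ≈ y)
  x ≟ y = map′ lower lift (em {Lift c (x ≈ y)})

  _≋?_ : (u v : V n) → Dec (u ≋ v)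
  u ≋? v = map′ lower lift (em {Lift c (u ≋ v)})

  nonzero-coordinate : {v : V n} → ¬ v ≋ 0ᴹ → ∃[ i ] ¬ v i ≈ 0#
  nonzero-coordinate {v = v} = ¬∀⟶∃¬ _ (λ i → v i ≈ 0#) (λ i → v i ≟ 0#)

  *-cancel-nonzeroʳ : ∀ {a b} → a · b ≈ 0# → ¬ b ≈ 0# → a ≈ 0#
  *-cancel-nonzeroʳ {a} {b} ab≈0 b≉0 = let b⁻¹ , bb⁻¹≈1 = inverse b b≉0 in begin
    a             ≈⟨ *-identityʳ a ⟨
    a · 1#        ≈⟨ *-congˡ bb⁻¹≈1 ⟨
    a · (b · b⁻¹) ≈⟨ *-assoc a b b⁻¹ ⟨
    a · b · b⁻¹   ≈⟨ *-congʳ ab≈0 ⟩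
    0# · b⁻¹      ≈⟨ zeroˡ b⁻¹ ⟩
    0#            ∎
    where open SetoidReasoning setoid

  *ₗ-cancel-nonzeroʳ : ∀ {a} {v : V n} → a *ₗ v ≋ 0ᴹ → ¬ v ≋ 0ᴹ → a ≈ 0#
  *ₗ-cancel-nonzeroʳ av≋0 v≉0 =
    let i , vᵢ≉0 = nonzero-coordinate v≉0 in *-cancel-nonzeroʳ (av≋0 i) vᵢ≉0

  -- Linear maps

  -- A map into `V d` also serves as a list of `d` linear conditions; codimensions and ranks are
  -- bounded by counting such conditions.
  record LinearMap (n m : ℕ) : Set (c ⊔ ℓ) where
    infixr 6 _⟨$⟩_
    field
      _⟨$⟩_  : V n → V m
      cong   : ∀ {u v} → u ≋ v → _⟨$⟩_ u ≋ _⟨$⟩_ v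
      +-homo : ∀ u v → _⟨$⟩_ (u +ᴹ v) ≋ _⟨$⟩_ u +ᴹ _⟨$⟩_ v
      *-homo : ∀ a v → _⟨$⟩_ (a *ₗ v) ≋ a *ₗ _⟨$⟩_ v

    0-homo : _⟨$⟩_ 0ᴹ ≋ 0ᴹ
    0-homo i = begin
      (_⟨$⟩_ 0ᴹ) i           ≈⟨ cong {0ᴹ} {0# *ₗ 0ᴹ} (λ _ → sym (zeroˡ 0#)) i ⟩
      (_⟨$⟩_ (0# *ₗ 0ᴹ)) i   ≈⟨ *-homo 0# 0ᴹ i ⟩
      0# · (_⟨$⟩_ 0ᴹ) i      ≈⟨ zeroˡ _ ⟩
      0#                     ∎
      where open SetoidReasoning setoid

    vanishes : ∀ {v} → v ≋ 0ᴹ → _⟨$⟩_ v ≋ 0ᴹ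
    vanishes v≋0 = ≋-trans (cong v≋0) 0-homo

  open LinearMap public

  fromHomomorphism : {h : V n → V m} →
    LeftModuleMorphisms.IsLeftModuleHomomorphism (F^ n) (F^ m) h → LinearMap n m
  fromHomomorphism {h = h} isHom = record
    { _⟨$⟩_  = h
    ; cong   = ⟦⟧-cong
    ; +-homo = +ᴹ-homo
    ; *-homo = *ₗ-homo
    }
    where open LeftModuleMorphisms.IsLeftModuleHomomorphism isHom

  _∘ₗ_ : LinearMap m l → LinearMap n m → LinearMap n l
  g ∘ₗ f = record
    { _⟨$⟩_  = λ v → g ⟨$⟩ f ⟨$⟩ v
    ; cong   = λ e → cong g (cong f e)
    ; +-homo = λ u v → ≋-trans (cong g (+-homo f u v)) (+-homo g _ _)
    ; *-homo = λ a v → ≋-trans (cong g (*-homo f a v)) (*-homo g a _)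
    }

  select : (Fin k → Fin n) → LinearMap n k
  select σ = record
    { _⟨$⟩_  = λ v i → v (σ i)
    ; cong   = λ e i → e (σ i)
    ; +-homo = λ _ _ _ → refl
    ; *-homo = λ _ _ _ → refl
    }

  idₗ : LinearMap n n
  idₗ = select λ i → i

  coordinate : Fin n → LinearMap n 1
  coordinate i = select λ _ → i

  scale : Carrier → LinearMap n n
  scale b = record
    { _⟨$⟩_  = b *ₗ_
    ; cong   = λ e i → *-congˡ (e i)
    ; +-homo = λ u v i → distribˡ b (u i) (v i)
    ; *-homo = λ a v i → solve 3 (λ b a v → b :* (a :* v) := a :* (b :* v)) refl b a (v i)
    }

  0ₗ : LinearMap n m
  0ₗ = record
    { _⟨$⟩_  = λ _ → 0ᴹ
    ; cong   = λ _ _ → refl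
    ; +-homo = λ _ _ _ → sym (+-identityˡ 0#)
    ; *-homo = λ a _ _ → sym (zeroʳ a)
    }

  ++-pointwise : ∀ {p} (P : Fin (k ℕ.+ l) → Set p) →
    (∀ i → P (i ↑ˡ l)) → (∀ j → P (k ↑ʳ j)) → ∀ i → P i
  ++-pointwise {zero}  P Pˡ Pʳ i       = Pʳ i
  ++-pointwise {suc k} P Pˡ Pʳ zero    = Pˡ zero
  ++-pointwise {suc k} P Pˡ Pʳ (suc i) = ++-pointwise (P ∘ suc) (Pˡ ∘ suc) Pʳ i

  ⟨_,_⟩ : LinearMap n k → LinearMap n l → LinearMap n (k ℕ.+ l)
  ⟨_,_⟩ {k = k} {l = l} f g = record
    { _⟨$⟩_  = fg
    ; cong   = λ {u} {v} e → ++-pointwise (λ i → fg u i ≈ fg v i)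
        (λ i → trans (fgˡ u i) (trans (cong f e i) (sym (fgˡ v i))))
        (λ j → trans (fgʳ u j) (trans (cong g e j) (sym (fgʳ v j))))
    ; +-homo = λ u v → ++-pointwise (λ i → fg (u +ᴹ v) i ≈ fg u i + fg v i)
        (λ i → trans (fgˡ (u +ᴹ v) i) (trans (+-homo f u v i) (sym (+-cong (fgˡ u i) (fgˡ v i)))))
        (λ j → trans (fgʳ (u +ᴹ v) j) (trans (+-homo g u v j) (sym (+-cong (fgʳ u j) (fgʳ v j)))))
    ; *-homo = λ a v → ++-pointwise (λ i → fg (a *ₗ v) i ≈ a · fg v i)
        (λ i → trans (fgˡ (a *ₗ v) i) (trans (*-homo f a v i) (sym (*-congˡ (fgˡ v i)))))
        (λ j → trans (fgʳ (a *ₗ v) j) (trans (*-homo g a v j) (sym (*-congˡ (fgʳ v j)))))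
    }
    where
    fg : _ → V (k ℕ.+ l)
    fg v = (f ⟨$⟩ v) ++ (g ⟨$⟩ v)
    fgˡ : ∀ v i → fg v (i ↑ˡ l) ≈ (f ⟨$⟩ v) i
    fgˡ v i = reflexive (lookup-++ˡ (f ⟨$⟩ v) (g ⟨$⟩ v) i)
    fgʳ : ∀ v j → fg v (k ↑ʳ j) ≈ (g ⟨$⟩ v) j
    fgʳ v j = reflexive (lookup-++ʳ (f ⟨$⟩ v) (g ⟨$⟩ v) j)

  ker-⟨⟩ˡ : (f : LinearMap n k) (g : LinearMap n l) → ∀ {v} → ⟨ f , g ⟩ ⟨$⟩ v ≋ 0ᴹ → f ⟨$⟩ v ≋ 0ᴹ
  ker-⟨⟩ˡ {l = l} f g {v} e i =
    trans (sym (reflexive (lookup-++ˡ (f ⟨$⟩ v) (g ⟨$⟩ v) i))) (e (i ↑ˡ l))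

  ker-⟨⟩ʳ : (f : LinearMap n k) (g : LinearMap n l) → ∀ {v} → ⟨ f , g ⟩ ⟨$⟩ v ≋ 0ᴹ → g ⟨$⟩ v ≋ 0ᴹ
  ker-⟨⟩ʳ {k = k} f g {v} e j =
    trans (sym (reflexive (lookup-++ʳ (f ⟨$⟩ v) (g ⟨$⟩ v) j))) (e (k ↑ʳ j))

  stack : (Fin k → LinearMap n d) → LinearMap n (k ℕ.* d)
  stack {zero}  f = 0ₗ
  stack {suc k} f = ⟨ f zero , stack (f ∘ suc) ⟩

  ker-stack : (f : Fin k → LinearMap n d) → ∀ {v} → stack f ⟨$⟩ v ≋ 0ᴹ → ∀ i → f i ⟨$⟩ v ≋ 0ᴹ
  ker-stack {suc k} f e zero    = ker-⟨⟩ˡ (f zero) (stack (f ∘ suc)) e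
  ker-stack {suc k} f e (suc i) = ker-stack (f ∘ suc) (ker-⟨⟩ʳ (f zero) (stack (f ∘ suc)) e) i

  combination : Vector (V n) k → LinearMap k n
  combination w = record
    { _⟨$⟩_  = λ a → linearCombination a w
    ; cong   = λ e j → sum-cong-≋ λ i → *-congʳ (e i)
    ; +-homo = λ a b j → trans (sum-cong-≋ λ i → distribʳ (w i j) (a i) (b i))
                               (∑-distrib-+ (λ i → a i · w i j) (λ i → b i · w i j))
    ; *-homo = λ b a j → trans (sum-cong-≋ λ i → *-assoc b (a i) (w i j))
                               (sym (*-distribˡ-sum b (λ i → a i · w i j)))
    }

  map-combination : (h : LinearMap n m) (a : V k) (w : Vector (V n) k) →
    h ⟨$⟩ linearCombination a w ≋ linearCombination a (map (h ⟨$⟩_) w)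
  map-combination {k = zero}  h a w = 0-homo h
  map-combination {k = suc k} h a w =
    ≋-trans (+-homo h (head a *ₗ head w) (linearCombination (tail a) (tail w)))
      λ j → +-cong (*-homo h (head a) (head w) j) (map-combination h (tail a) (tail w) j)

  combination-vanishes : (a : V k) {w : Vector (V n) k} → (∀ i → w i ≋ 0ᴹ) → linearCombination a w ≋ 0ᴹ
  combination-vanishes {k = zero}  a e j = refl
  combination-vanishes {k = suc k} a {w} e j = begin
    a zero · w zero j + linearCombination (tail a) (tail w) j
      ≈⟨ +-cong (trans (*-congˡ (e zero j)) (zeroʳ _)) (combination-vanishes (tail a) (e ∘ suc) j) ⟩
    0# + 0# ≈⟨ +-identityˡ 0# ⟩
    0#      ∎
    where open SetoidReasoning setoid

  -- Homogeneous linear systems.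

  graph : LinearMap n 1 → LinearMap n (suc n)
  graph f = ⟨ f , idₗ ⟩

  -- For y inverse to h δ₀ p, the first coordinate is chosen so that the p-th
  -- coordinate of h vanishes.
  onto-kernel : LinearMap (suc n) m → Fin m → Carrier → LinearMap n (suc n)
  onto-kernel h p y = graph (scale (- y) ∘ₗ (coordinate p ∘ₗ (h ∘ₗ graph 0ₗ)))

  δ₀ : V (suc n)
  δ₀ = 1# ∷ 0ᴹ

  -- Gaussian elimination: unless `δ₀` itself is a solution, some equation `p` involves the first
  -- unknown. Solving it for that unknown leaves one equation and one unknown fewer.
  nontrivial-kernel : (h : LinearMap n d) → d ℕ.< n → ∃[ v ] (¬ v ≋ 0ᴹ × h ⟨$⟩ v ≋ 0ᴹ)
  nontrivial-kernel {suc n} h d<n with (h ⟨$⟩ δ₀) ≋? 0ᴹ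
  ... | yes hδ₀≋0 = δ₀ , (λ e → 1≉0 (e zero)) , hδ₀≋0
  ... | no  hδ₀≉0 with nonzero-coordinate hδ₀≉0
  nontrivial-kernel {suc n} {suc d} h (s≤s d<n) | no _ | p , hp≉0
    with inverse _ hp≉0
  -- Equation `p` holds on the image of `onto-kernel h p y`; `punchIn p` keeps the others.
  ... | y , hp·y≈1 with nontrivial-kernel (select (punchIn p) ∘ₗ (h ∘ₗ onto-kernel h p y)) d<n
  ... | v , v≉0 , e = x , (λ x≋0 → v≉0 (x≋0 ∘ suc)) , hx≋0
    where
    open SetoidReasoning setoid
    v₀ x : V (suc n)
    v₀ = graph 0ₗ ⟨$⟩ v
    x  = onto-kernel h p y ⟨$⟩ v
    s : Carrier
    s = - y · (h ⟨$⟩ v₀) p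
    x≋ : x ≋ s *ₗ δ₀ +ᴹ v₀
    x≋ zero    = sym (trans (+-identityʳ _) (*-identityʳ s))
    x≋ (suc i) = sym (trans (+-congʳ (zeroʳ s)) (+-identityˡ _))
    hxp≈0 : (h ⟨$⟩ x) p ≈ 0#
    hxp≈0 = begin
      (h ⟨$⟩ x) p
        ≈⟨ cong h x≋ p ⟩
      (h ⟨$⟩ (s *ₗ δ₀ +ᴹ v₀)) p
        ≈⟨ +-homo h (s *ₗ δ₀) v₀ p ⟩
      (h ⟨$⟩ s *ₗ δ₀) p + (h ⟨$⟩ v₀) p
        ≈⟨ +-congʳ (*-homo h s δ₀ p) ⟩
      - y · (h ⟨$⟩ v₀) p · (h ⟨$⟩ δ₀) p + (h ⟨$⟩ v₀) p
        ≈⟨ +-congʳ (solve 3 (λ y b a → y :* b :* a := (a :* y) :* b) refl (- y) ((h ⟨$⟩ v₀) p) ((h ⟨$⟩ δ₀) p)) ⟩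
      (h ⟨$⟩ δ₀) p · - y · (h ⟨$⟩ v₀) p + (h ⟨$⟩ v₀) p
        ≈⟨ +-congʳ (*-congʳ (trans (sym (-‿distribʳ-* _ y)) (-‿cong hp·y≈1))) ⟩
      - 1# · (h ⟨$⟩ v₀) p + (h ⟨$⟩ v₀) p
        ≈⟨ +-congˡ (*-identityˡ _) ⟨
      - 1# · (h ⟨$⟩ v₀) p + 1# · (h ⟨$⟩ v₀) p
        ≈⟨ distribʳ _ (- 1#) 1# ⟨
      (- 1# + 1#) · (h ⟨$⟩ v₀) p
        ≈⟨ *-congʳ (-‿inverseˡ 1#) ⟩
      0# · (h ⟨$⟩ v₀) p
        ≈⟨ zeroˡ _ ⟩
      0# ∎
    hx≋0 : h ⟨$⟩ x ≋ 0ᴹ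
    hx≋0 i with p ≟ᶠ i
    ... | yes ≡.refl = hxp≈0
    ... | no  p≢i    = trans (reflexive (≡.cong (h ⟨$⟩ x) (≡.sym (punchIn-punchOut p≢i)))) (e (punchOut p≢i))

  -- Subspaces

  whole : Subspace n
  whole = record
    { Member    = λ _ → ⊤
    ; respects  = λ _ _ → tt
    ; 0-closed  = tt
    ; +-closed  = λ _ _ → tt
    ; *ₗ-closed = λ _ _ → tt
    }

  kernel : LinearMap n m → Subspace n
  kernel h = record
    { Member    = λ v → Lift c (h ⟨$⟩ v ≋ 0ᴹ)
    ; respects  = λ e (lift f) → lift (≋-trans (cong h (≋-sym e)) f)
    ; 0-closed  = lift (0-homo h)
    ; +-closed  = λ {u} {v} (lift e) (lift f) → lift (≋-trans (+-homo h u v)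
                    λ i → trans (+-cong (e i) (f i)) (+-identityˡ 0#))
    ; *ₗ-closed = λ a {v} (lift e) → lift (≋-trans (*-homo h a v)
                    λ i → trans (*-congˡ (e i)) (zeroʳ a))
    }

  _⊓_ : Subspace n → Subspace n → Subspace n
  U ⊓ W = record
    { Member    = λ v → Member U v × Member W v
    ; respects  = λ e (p , q) → respects U e p , respects W e q
    ; 0-closed  = 0-closed U , 0-closed W
    ; +-closed  = λ (p , q) (p′ , q′) → +-closed U p p′ , +-closed W q q′
    ; *ₗ-closed = λ a (p , q) → *ₗ-closed U a p , *ₗ-closed W a q
    }
    where open Subspace

  open Subspace using (respects; 0-closed; +-closed; *ₗ-closed)

  -- The sum of `S` and the span of `z`: the vectors that some combination of `z` moves into `S`,
  -- the sign being absorbed by the coefficients.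
  adjoin : Subspace n → Vector (V n) k → Subspace n
  adjoin S z = record
    { Member    = λ v → ∃[ a ] Member S (v +ᴹ linearCombination a z)
    ; respects  = λ e (a , p) → a , respects S (λ i → +-congʳ (e i)) p
    ; 0-closed  = 0ᴹ , respects S (λ i → sym (trans (+-identityˡ _) (0-homo (combination z) i))) (0-closed S)
    ; +-closed  = λ {u} {v} (a , p) (b , q) → a +ᴹ b ,
        respects S (λ i → trans
            (solve 4 (λ u v x y → (u :+ x) :+ (v :+ y) := (u :+ v) :+ (x :+ y)) refl (u i) (v i) _ _)
            (+-congˡ (sym (+-homo (combination z) a b i))))
          (+-closed S p q)
    ; *ₗ-closed = λ b {v} (a , p) → b *ₗ a ,
        respects S (λ i → trans (distribˡ b (v i) _) (+-congˡ (sym (*-homo (combination z) b a i))))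
          (*ₗ-closed S b p)
    }

  span : Vector (V n) k → Subspace n
  span w = record
    { Member    = λ v → Σ[ a ∈ V _ ] v ≋ linearCombination a w
    ; respects  = λ e (a , p) → a , ≋-trans (≋-sym e) p
    ; 0-closed  = 0ᴹ , ≋-sym (0-homo (combination w))
    ; +-closed  = λ (a , p) (b , q) → a +ᴹ b ,
        λ i → trans (+-cong (p i) (q i)) (sym (+-homo (combination w) a b i))
    ; *ₗ-closed = λ b (a , p) → b *ₗ a ,
        λ i → trans (*-congˡ (p i)) (sym (*-homo (combination w) b a i))
    }

  combination∈ : (U : Subspace n) (a : V k) {w : Vector (V n) k} →
    (∀ i → Member U (w i)) → Member U (linearCombination a w)
  combination∈ {k = zero}  U a w∈U = 0-closed U
  combination∈ {k = suc k} U a w∈U =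
    +-closed U (*ₗ-closed U (head a) (w∈U zero)) (combination∈ U (tail a) (w∈U ∘ suc))

  combination-δ₀ : (w : Vector (V n) (suc k)) → linearCombination δ₀ w ≋ head w
  combination-δ₀ w j =
    trans (+-cong (*-identityˡ _) (0-homo (combination (tail w)) j)) (+-identityʳ _)

  member-span : (w : Vector (V n) k) → ∀ i → Member (span w) (w i)
  member-span w zero    = δ₀ , ≋-sym (combination-δ₀ w)
  member-span w (suc i) =
    let a , p = member-span (tail w) i in
    0# ∷ a , λ j → trans (p j) (sym (trans (+-congʳ (zeroˡ _)) (+-identityˡ _)))

  span-dimension : (w : Vector (V n) k) → LinearlyIndependent w → HasDimension (span w) k
  span-dimension w indep = w , record
    { members     = member-span w
    ; independent = indep
    ; spanning    = λ v p → p
    }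

  *-closed⁻ : (S : Subspace n) {a : Carrier} {v : V n} → ¬ a ≈ 0# → Member S (a *ₗ v) → Member S v
  *-closed⁻ S {a} {v} a≉0 p = let y , ay≈1 = inverse a a≉0 in
    respects S (λ i → trans (sym (*-assoc y a (v i)))
                     (trans (*-congʳ (trans (*-comm y a) ay≈1)) (*-identityˡ _)))
      (*ₗ-closed S y p)

  +-closed⁻ˡ : (S : Subspace n) {u v : V n} → Member S u → Member S (u +ᴹ v) → Member S v
  +-closed⁻ˡ S {u} {v} p q = respects S (λ i → begin
      - 1# · u i + (u i + v i)  ≈⟨ +-congʳ (trans (sym (-‿distribˡ-* 1# (u i))) (-‿cong (*-identityˡ _))) ⟩
      - u i + (u i + v i)       ≈⟨ +-assoc _ _ _ ⟨
      - u i + u i + v i         ≈⟨ +-congʳ (-‿inverseˡ _) ⟩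
      0# + v i                  ≈⟨ +-identityˡ _ ⟩
      v i                       ∎)
    (+-closed S (*ₗ-closed S (- 1#) p) q)
    where open SetoidReasoning setoid

  -- Separating maps.

  -- Injectivity of `ψ` on `S`, which stands in for the bound `d` on the dimension of `S`.
  Separates : LinearMap n d → Subspace n → Set (c ⊔ ℓ)
  Separates ψ S = ∀ v → Member S v → ψ ⟨$⟩ v ≋ 0ᴹ → v ≋ 0ᴹ

  -- Since `T` lies in `S` plus a line and `ψ` is injective on `S`, the kernel of `ψ` on `T` is at
  -- most a line. A coordinate that is nonzero on that line separates it.
  separate-line : (S T : Subspace n) (z : V n) (ψ : LinearMap n d) → Separates ψ S →
    (∀ v → Member T v → ∃[ a ] Member S (v +ᴹ a *ₗ z)) →
    Σ[ ψ′ ∈ LinearMap n (suc d) ] Separates ψ′ T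
  separate-line S T z ψ sep T⊆S+z with em {Σ[ p ∈ V _ ] Member T p × ψ ⟨$⟩ p ≋ 0ᴹ × ¬ p ≋ 0ᴹ}
  -- Here `ψ` is already injective on `T`; a zero coordinate pads it to `suc d`.
  ... | no  none = ⟨ 0ₗ {m = 1} , ψ ⟩ , λ v v∈T e →
    decidable-stable (v ≋? 0ᴹ) λ v≉0 → none (v , v∈T , ker-⟨⟩ʳ (0ₗ {m = 1}) ψ {v} e , v≉0)
  ... | yes (p , p∈T , ψp≋0 , p≉0) = ⟨ coordinate i , ψ ⟩ , sep′
    where
    open SetoidReasoning setoid
    i = proj₁ (nonzero-coordinate p≉0)
    pᵢ≉0 = proj₂ (nonzero-coordinate p≉0)
    b = proj₁ (T⊆S+z p p∈T)
    p+bz∈S = proj₂ (T⊆S+z p p∈T)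
    b≉0 : ¬ b ≈ 0#
    b≉0 b≈0 = p≉0 (sep p (respects S (λ j → trans (+-congˡ (trans (*-congʳ b≈0) (zeroˡ _))) (+-identityʳ _)) p+bz∈S) ψp≋0)
    b⁻¹ = proj₁ (inverse b b≉0)
    bb⁻¹≈1 = proj₂ (inverse b b≉0)
    sep′ : Separates ⟨ coordinate i , ψ ⟩ T
    sep′ q q∈T e with T⊆S+z q q∈T
    ... | a , q+az∈S = λ j → begin
          q j              ≈⟨ +-identityʳ _ ⟨
          q j + 0#         ≈⟨ +-congˡ (trans (*-congʳ t≈0) (zeroˡ _)) ⟨
          q j + t · p j    ≈⟨ q+tp≋0 j ⟩
          0#               ∎
      where
      t : Carrier
      t = - (a · b⁻¹)
      tb≈-a : t · b ≈ - a
      tb≈-a = trans (sym (-‿distribˡ-* _ b)) (-‿cong (trans (*-assoc a b⁻¹ b)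
                (trans (*-congˡ (trans (*-comm b⁻¹ b) bb⁻¹≈1)) (*-identityʳ a))))
      -- The choice of `t` cancels the multiple of `z`, so `q + tp` lies in `S` and in the kernel of
      -- `ψ`.
      q+tp≋0 : q +ᴹ t *ₗ p ≋ 0ᴹ
      q+tp≋0 = sep _
        (respects S (λ j → begin
          (q j + a · z j) + t · (p j + b · z j)
            ≈⟨ solve 6 (λ q a z t p b → (q :+ a :* z) :+ t :* (p :+ b :* z) := (q :+ t :* p) :+ (a :+ t :* b) :* z)
                 refl (q j) a (z j) t (p j) b ⟩
          (q j + t · p j) + (a + t · b) · z j
            ≈⟨ +-congˡ (*-congʳ (trans (+-congˡ tb≈-a) (-‿inverseʳ a))) ⟩
          (q j + t · p j) + 0# · z j
            ≈⟨ trans (+-congˡ (zeroˡ _)) (+-identityʳ _) ⟩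
          q j + t · p j ∎)
          (+-closed S q+az∈S (*ₗ-closed S t p+bz∈S)))
        (lower (+-closed (kernel ψ) {q} (lift (ker-⟨⟩ʳ (coordinate i) ψ {q} e)) (*ₗ-closed (kernel ψ) t {p} (lift ψp≋0))))
      t≈0 : t ≈ 0#
      t≈0 = *-cancel-nonzeroʳ (begin
        t · p i        ≈⟨ +-identityˡ _ ⟨
        0# + t · p i   ≈⟨ +-congʳ (ker-⟨⟩ˡ (coordinate i) ψ {q} e zero) ⟨
        q i + t · p i  ≈⟨ q+tp≋0 i ⟩
        0#             ∎) pᵢ≉0

  -- Each adjoined vector costs one further coordinate.
  separate-adjoin : (S : Subspace n) (z : Vector (V n) k) (ψ : LinearMap n d) → Separates ψ S →
    Σ[ ψ′ ∈ LinearMap n (k ℕ.+ d) ] Separates ψ′ (adjoin S z)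
  separate-adjoin {k = zero}  S z ψ sep = ψ , λ v (_ , p) → sep v (respects S (λ _ → +-identityʳ _) p)
  separate-adjoin {k = suc k} S z ψ sep =
    let ψ′ , sep′ = separate-adjoin S (tail z) ψ sep in
    separate-line (adjoin S (tail z)) (adjoin S z) (head z) ψ′ sep′
      λ v (a , p) → head a , tail a , respects S (λ _ → sym (+-assoc _ _ _)) p

  independent-tail : {w : Vector (V n) (suc k)} → LinearlyIndependent w → LinearlyIndependent (tail w)
  independent-tail indep a e i =
    indep (0# ∷ a) (λ j → trans (+-congʳ (zeroˡ _)) (trans (+-identityˡ _) (e j))) (suc i)

  -- Alternating bilinear maps.

  module _ {n m : ℕ} (φ : AlternatingBilinearMap n m) where

    open AlternatingBilinearMap φ renaming (⟦_,_⟧ to B)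

    B-left : V n → LinearMap n m
    B-left v = fromHomomorphism (linearˡ v)

    B-right : V n → LinearMap n m
    B-right u = fromHomomorphism (linearʳ u)

    B-skew : ∀ u v i → B u v i ≈ - B v u i
    B-skew u v i = +-inverseʳ-unique (B v u i) (B u v i) (begin
      B v u i + B u v i
        ≈⟨ +-comm _ _ ⟩
      B u v i + B v u i
        ≈⟨ +-cong (trans (+-congʳ (alternating u i)) (+-identityˡ _))
                  (trans (+-congˡ (alternating v i)) (+-identityʳ _)) ⟨
      (B u u i + B u v i) + (B v u i + B v v i)
        ≈⟨ +-cong (+-homo (B-right u) u v i) (+-homo (B-right v) u v i) ⟨
      B u (u +ᴹ v) i + B v (u +ᴹ v) i
        ≈⟨ +-homo (B-left (u +ᴹ v)) u v i ⟨
      B (u +ᴹ v) (u +ᴹ v) i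
        ≈⟨ alternating (u +ᴹ v) i ⟩
      0# ∎)
      where open SetoidReasoning setoid

    -- Collects all contributions of `v` into one value `B _ v`, since `B v v` vanishes and `B` is
    -- skew. This drives the induction for both kinds of families below.
    B-expand : ∀ a b v x y →
      B (a *ₗ v +ᴹ x) (b *ₗ v +ᴹ y) ≋ B (b *ₗ x +ᴹ (- a) *ₗ y) v +ᴹ B x y
    B-expand a b v x y i = begin
      B (a *ₗ v +ᴹ x) (b *ₗ v +ᴹ y) i
        ≈⟨ +-homo (B-left _) (a *ₗ v) x i ⟩
      B (a *ₗ v) (b *ₗ v +ᴹ y) i + B x (b *ₗ v +ᴹ y) i
        ≈⟨ +-cong (*-homo (B-left _) a v i) (split x) ⟩
      a · B v (b *ₗ v +ᴹ y) i + (b · B x v i + B x y i)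
        ≈⟨ +-congʳ (*-congˡ (trans (split v)
             (trans (+-congʳ (trans (*-congˡ (alternating v i)) (zeroʳ b))) (+-identityˡ _)))) ⟩
      a · B v y i + (b · B x v i + B x y i)
        ≈⟨ +-congʳ (trans (*-congˡ (B-skew v y i)) (trans (sym (-‿distribʳ-* a _)) (-‿distribˡ-* a _))) ⟩
      - a · B y v i + (b · B x v i + B x y i)
        ≈⟨ trans (sym (+-assoc _ _ _)) (+-congʳ (+-comm _ _)) ⟩
      (b · B x v i + - a · B y v i) + B x y i
        ≈⟨ +-congʳ (+-cong (*-homo (B-left v) b x i) (*-homo (B-left v) (- a) y i)) ⟨
      (B (b *ₗ x) v i + B ((- a) *ₗ y) v i) + B x y i
        ≈⟨ +-congʳ (+-homo (B-left v) (b *ₗ x) ((- a) *ₗ y) i) ⟨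
      B (b *ₗ x +ᴹ (- a) *ₗ y) v i + B x y i ∎
      where
      open SetoidReasoning setoid
      split : ∀ u → B u (b *ₗ v +ᴹ y) i ≈ b · B u v i + B u y i
      split u = trans (+-homo (B-right u) (b *ₗ v) y i) (+-congʳ (*-homo (B-right u) b v i))

    -- The restriction of B x to U has rank larger than D exactly when no D linear
    -- conditions on u ∈ U force B x u to vanish.
    Rich : ℕ → Subspace n → Set (c ⊔ ℓ)
    Rich D U = ∀ x → Member U x → ¬ x ≋ 0ᴹ → ∀ d (Λ : LinearMap n d) → d ℕ.≤ D →
      ∃[ u ] (Member U u × Λ ⟨$⟩ u ≋ 0ᴹ × ¬ B x u ≋ 0ᴹ)

    -- Equivalently, the values `B (w i) u` are linearly independent in the quotient by `S`.
    IndependentModulo : Subspace m → Vector (V n) k → V n → Set (c ⊔ ℓ)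
    IndependentModulo S w u = ∀ a → Member S (B (linearCombination a w) u) → a ≋ 0ᴹ

    -- Vectors whose pairings are independent modulo a subspace.

    module _ {D : ℕ} {U : Subspace n} (rich : Rich D U)
             {S : Subspace m} {d : ℕ} (ψ : LinearMap m d) (sep : Separates ψ S) where

      -- Induction on `k`. If `u` is good for `tail w` but not for `w`, some `x` with leading
      -- coefficient 1 has `B x u` in `S`. Richness gives `v` with `B x v` nonzero such that the
      -- values `B (w i) v` span a subspace meeting `S` plus the span of the old values trivially;
      -- then `u + v` is good for `w`.
      independentModulo : (w : Vector (V n) k) → LinearlyIndependent w → (∀ i → Member U (w i)) →
        k ℕ.* (k ℕ.+ d) ℕ.≤ D → ∃[ u ] (Member U u × IndependentModulo S w u)
      independentModulo {zero}  w indep w∈U bound = 0ᴹ , 0-closed U , λ _ _ ()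
      independentModulo {suc k} w indep w∈U bound
        with independentModulo (tail w) (independent-tail {w = w} indep) (w∈U ∘ suc)
               (ℕₚ.≤-trans (ℕₚ.*-mono-≤ (ℕₚ.n≤1+n k) (ℕₚ.n≤1+n (k ℕ.+ d))) bound)
      ... | u , u∈U , good
        with em {Σ[ b ∈ V k ] Member S (B (head w +ᴹ linearCombination b (tail w)) u)}
      ... | no  none = u , u∈U , good′
        where
        good′ : IndependentModulo S w u
        good′ a p with head a ≟ 0#
        ... | yes a₀≈0 = λ { zero → a₀≈0 ; (suc i) → good (tail a) (respects S
                  (cong (B-left u) (λ i → trans (+-congʳ (trans (*-congʳ a₀≈0) (zeroˡ _))) (+-identityˡ _))) p) i }
        -- Dividing by `head a` turns the relation into one with leading coefficient 1.
        ... | no  a₀≉0 = contradiction (y *ₗ tail a , *-closed⁻ S a₀≉0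
                  (respects S (≋-trans (cong (B-left u) rescale) (*-homo (B-left u) (head a) _)) p)) none
          where
          y = proj₁ (inverse _ a₀≉0)
          rescale : linearCombination a w ≋ head a *ₗ (head w +ᴹ linearCombination (y *ₗ tail a) (tail w))
          rescale j = begin
            head a · head w j + t
              ≈⟨ +-congˡ (trans (*-congʳ (proj₂ (inverse _ a₀≉0))) (*-identityˡ t)) ⟨
            head a · head w j + head a · y · t
              ≈⟨ solve 4 (λ a w y t → a :* w :+ a :* y :* t := a :* (w :+ y :* t)) refl (head a) (head w j) y t ⟩
            head a · (head w j + y · t)
              ≈⟨ *-congˡ (+-congˡ (*-homo (combination (tail w)) y (tail a) j)) ⟨
            head a · (head w j + linearCombination (y *ₗ tail a) (tail w) j) ∎
            where
            open SetoidReasoning setoid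
            t = linearCombination (tail a) (tail w) j
      ... | yes (b , Bxu∈S) = u +ᴹ v , +-closed U u∈U v∈U , good′
        where
        open SetoidReasoning setoid
        x : V n
        x = head w +ᴹ linearCombination b (tail w)
        x≋ : x ≋ linearCombination (1# ∷ b) w
        x≋ j = +-congʳ (sym (*-identityˡ _))
        x∈U : Member U x
        x∈U = +-closed U (w∈U zero) (combination∈ U b (w∈U ∘ suc))
        x≉0 : ¬ x ≋ 0ᴹ
        x≉0 x≋0 = 1≉0 (indep (1# ∷ b) (≋-trans (≋-sym x≋) x≋0) zero)

        T : Subspace m
        T = adjoin S (λ i → B (tail w i) u)
        separation = separate-adjoin S (λ i → B (tail w i) u) ψ sep
        ψ′ = proj₁ separation

        Λ : Fin (suc k) → LinearMap n (k ℕ.+ d)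
        Λ i = ψ′ ∘ₗ B-right (w i)
        -- There are `suc k` maps with `k + d` conditions each, within the bound
        -- `suc k * (suc k + d)`.
        choice = rich x x∈U x≉0 _ (stack Λ)
          (ℕₚ.≤-trans (ℕₚ.*-monoʳ-≤ (suc k) (ℕₚ.n≤1+n (k ℕ.+ d))) bound)
        v = proj₁ choice
        v∈U = proj₁ (proj₂ choice)
        Λv≋0 = proj₁ (proj₂ (proj₂ choice))
        Bxv≉0 = proj₂ (proj₂ (proj₂ choice))

        -- For z in the span of w with B z (u + v) ∈ S, the value B z v lies in T
        -- and is killed by ψ′, so it vanishes; hence z is a multiple of x.
        good′ : IndependentModulo S w (u +ᴹ v)
        good′ a p = λ { zero → a₀≈0 ; (suc i) → begin
            a (suc i)                                   ≈⟨ sum-minus i ⟩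
            a′ i + head a · b i                         ≈⟨ +-cong (a′≋0 i) (trans (*-congʳ a₀≈0) (zeroˡ _)) ⟩
            0# + 0#                                     ≈⟨ +-identityˡ 0# ⟩
            0#                                          ∎ }
          where
          z : V n
          z = linearCombination a w
          -- Subtracting `head a` times `x` from `z` leaves a combination `z′` of `tail w`, for
          -- which `u` is already good.
          a′ : V k
          a′ = tail a +ᴹ (- head a) *ₗ b
          z′ : V n
          z′ = linearCombination a′ (tail w)
          sum-minus : ∀ i → a (suc i) ≈ a′ i + head a · b i
          sum-minus i = sym (begin
            (a (suc i) + - head a · b i) + head a · b i  ≈⟨ +-assoc _ _ _ ⟩
            a (suc i) + (- head a · b i + head a · b i)  ≈⟨ +-congˡ (distribʳ _ _ _) ⟨
            a (suc i) + (- head a + head a) · b i        ≈⟨ +-congˡ (trans (*-congʳ (-‿inverseˡ _)) (zeroˡ _)) ⟩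
            a (suc i) + 0#                               ≈⟨ +-identityʳ _ ⟩
            a (suc i)                                    ∎)
          z≋ : z ≋ head a *ₗ x +ᴹ z′
          z≋ j = begin
            head a · head w j + linearCombination (tail a) (tail w) j
              ≈⟨ +-congˡ (trans (cong (combination (tail w)) sum-minus j) (+-homo (combination (tail w)) a′ (head a *ₗ b) j)) ⟩
            head a · head w j + (z′ j + linearCombination (head a *ₗ b) (tail w) j)
              ≈⟨ +-congˡ (+-congˡ (*-homo (combination (tail w)) (head a) b j)) ⟩
            head a · head w j + (z′ j + head a · linearCombination b (tail w) j)
              ≈⟨ solve 4 (λ a w z t → a :* w :+ (z :+ a :* t) := a :* (w :+ t) :+ z) refl (head a) (head w j) (z′ j) _ ⟩
            head a · x j + z′ j ∎
          Bz : ∀ t → B z t ≋ head a *ₗ B x t +ᴹ B z′ t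
          Bz t = ≋-trans (cong (B-left t) z≋) (≋-trans (+-homo (B-left t) (head a *ₗ x) z′)
                   λ j → +-congʳ (*-homo (B-left t) (head a) x j))
          Bz′u+Bzv∈S : Member S (B z′ u +ᴹ B z v)
          Bz′u+Bzv∈S = +-closed⁻ˡ S (*ₗ-closed S (head a) Bxu∈S)
            (respects S (λ j → trans (+-homo (B-right z) u v j) (trans (+-congʳ (Bz u j)) (+-assoc _ _ _))) p)
          Bzv≋0 : B z v ≋ 0ᴹ
          Bzv≋0 = proj₂ separation (B z v)
            (a′ , respects S (λ j → trans (+-comm _ _) (+-congˡ (map-combination (B-left u) a′ (tail w) j))) Bz′u+Bzv∈S)
            (≋-trans (map-combination (ψ′ ∘ₗ B-left v) a w) (combination-vanishes a (ker-stack Λ Λv≋0)))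
          a′≋0 : a′ ≋ 0ᴹ
          a′≋0 = good a′ (respects S (λ j → trans (+-congˡ (Bzv≋0 j)) (+-identityʳ _)) Bz′u+Bzv∈S)
          -- Now `B z v` is `head a` times `B x v`, and `B x v` is nonzero.
          a₀≈0 : head a ≈ 0#
          a₀≈0 = *ₗ-cancel-nonzeroʳ (λ j → begin
            head a · B x v j                ≈⟨ +-identityʳ _ ⟨
            head a · B x v j + 0#           ≈⟨ +-congˡ (vanishes (B-left v) (vanishes (combination (tail w)) a′≋0) j) ⟨
            head a · B x v j + B z′ v j     ≈⟨ Bz v j ⟨
            B z v j                         ≈⟨ Bzv≋0 j ⟩
            0#                              ∎) Bxv≉0

    -- Families spanning a space that avoids the section.

    -- `S` contains all values of `B` on the span of `w`, and `separates` bounds its dimension by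
    -- `size`. `complete` says that two vectors of the span pair to zero only if all 2 × 2 minors of
    -- their coefficients vanish.
    record CompleteFamily (U : Subspace n) (k : ℕ) : Set (Level.suc (c ⊔ ℓ)) where
      field
        w           : Vector (V n) k
        members     : ∀ i → Member U (w i)
        independent : LinearlyIndependent w
        S           : Subspace m
        size        : ℕ
        size≤k²     : size ℕ.≤ k ℕ.* k
        ψ           : LinearMap m size
        separates   : Separates ψ S
        values      : ∀ a b → Member S (B (linearCombination a w) (linearCombination b w))
        complete    : ∀ a b → B (linearCombination a w) (linearCombination b w) ≋ 0ᴹ →
                      ∀ i j → a i · b j ≈ a j · b i

    emptyFamily : (U : Subspace n) → CompleteFamily U 0
    emptyFamily U = record
      { w           = λ ()
      ; members     = λ ()
      ; independent = λ _ _ ()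
      -- The zero subspace, separated by the map to `V 0`.
      ; S           = kernel idₗ
      ; size        = 0
      ; size≤k²     = z≤n
      ; ψ           = 0ₗ
      ; separates   = λ _ (lift v≋0) _ → v≋0
      ; values      = λ a b → lift (0-homo (B-left _))
      ; complete    = λ _ _ _ ()
      }

    -- By `B-expand`, a value is `B (Σ minorᵢ wᵢ) u` plus an old value, which lies in `S`. If the
    -- sum vanishes, so do the minors involving `u`, by independence modulo `S`; the old value is
    -- then zero and `complete` handles the other minors.
    extendFamily : {U : Subspace n} (C : CompleteFamily U k) (u : V n) → Member U u →
      LinearlyIndependent (u ∷ CompleteFamily.w C) →
      IndependentModulo (CompleteFamily.S C) (CompleteFamily.w C) u → CompleteFamily U (suc k)
    extendFamily {k = k} C u u∈U indep good = record
      { w           = u ∷ w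
      ; members     = λ { zero → u∈U ; (suc i) → members i }
      ; independent = indep
      ; S           = adjoin S (λ i → B (w i) u)
      ; size        = k ℕ.+ size
      ; size≤k²     = ℕₚ.≤-trans (ℕₚ.+-mono-≤ (ℕₚ.n≤1+n k) (ℕₚ.≤-trans size≤k² (ℕₚ.*-monoʳ-≤ k (ℕₚ.n≤1+n k))))
                        ℕₚ.≤-refl
      ; ψ           = proj₁ separation
      ; separates   = proj₂ separation
      -- The coefficients are negated because `adjoin` adds its combination in order to land in `S`.
      ; values      = λ a b → - 1# *ₗ minor a b , respects S (≋-sym (values-lemma a b)) (values (tail a) (tail b))
      ; complete    = complete′
      }
      where
      open CompleteFamily C
      open SetoidReasoning setoid
      separation = separate-adjoin S (λ i → B (w i) u) ψ separates
      minor : V (suc k) → V (suc k) → V k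
      minor a b = head b *ₗ tail a +ᴹ (- head a) *ₗ tail b
      expand : ∀ a b → B (linearCombination a (u ∷ w)) (linearCombination b (u ∷ w)) ≋
        B (linearCombination (minor a b) w) u +ᴹ B (linearCombination (tail a) w) (linearCombination (tail b) w)
      expand a b = ≋-trans (B-expand (head a) (head b) u (linearCombination (tail a) w) (linearCombination (tail b) w))
        λ j → +-congʳ (cong (B-left u) (λ i → sym (trans
          (+-homo (combination w) (head b *ₗ tail a) ((- head a) *ₗ tail b) i)
          (+-cong (*-homo (combination w) (head b) (tail a) i) (*-homo (combination w) (- head a) (tail b) i)))) j)
      values-lemma : ∀ a b →
        B (linearCombination a (u ∷ w)) (linearCombination b (u ∷ w))
          +ᴹ linearCombination (- 1# *ₗ minor a b) (λ i → B (w i) u)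
        ≋ B (linearCombination (tail a) w) (linearCombination (tail b) w)
      values-lemma a b j = begin
        B (linearCombination a (u ∷ w)) (linearCombination b (u ∷ w)) j + linearCombination (- 1# *ₗ minor a b) (λ i → B (w i) u) j
          ≈⟨ +-cong (expand a b j) (trans (*-homo (combination (λ i → B (w i) u)) (- 1#) (minor a b) j)
               (*-congˡ (sym (map-combination (B-left u) (minor a b) w j)))) ⟩
        (p + q) + - 1# · p
          ≈⟨ +-congˡ (trans (sym (-‿distribˡ-* 1# p)) (-‿cong (*-identityˡ p))) ⟩
        (p + q) + - p
          ≈⟨ solve 3 (λ p q r → (p :+ q) :+ r := (p :+ r) :+ q) refl p q (- p) ⟩
        (p + - p) + q
          ≈⟨ trans (+-congʳ (-‿inverseʳ p)) (+-identityˡ q) ⟩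
        q ∎
        where
        p = B (linearCombination (minor a b) w) u j
        q = B (linearCombination (tail a) w) (linearCombination (tail b) w) j
      complete′ : ∀ a b → B (linearCombination a (u ∷ w)) (linearCombination b (u ∷ w)) ≋ 0ᴹ →
                  ∀ i j → a i · b j ≈ a j · b i
      complete′ a b e = λ
        { zero    zero    → refl
        ; zero    (suc j) → first-row j
        ; (suc i) zero    → sym (first-row i)
        ; (suc i) (suc j) → complete (tail a) (tail b) rest≋0 i j
        }
        where
        sum≋0 = ≋-trans (≋-sym (expand a b)) e
        minor≋0 : minor a b ≋ 0ᴹ
        minor≋0 = good (minor a b) (+-closed⁻ˡ S (values (tail a) (tail b))
          (respects S (λ j → sym (trans (+-comm _ _) (sum≋0 j))) (0-closed S)))
        rest≋0 : B (linearCombination (tail a) w) (linearCombination (tail b) w) ≋ 0ᴹ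
        rest≋0 j = trans (sym (+-identityˡ _))
          (trans (+-congʳ (sym (vanishes (B-left u) (vanishes (combination w) minor≋0) j))) (sum≋0 j))
        first-row : ∀ j → a zero · b (suc j) ≈ a (suc j) · b zero
        first-row j = begin
          a zero · b (suc j)
            ≈⟨ +-identityˡ _ ⟨
          0# + a zero · b (suc j)
            ≈⟨ +-congʳ (minor≋0 j) ⟨
          (b zero · a (suc j) + - a zero · b (suc j)) + a zero · b (suc j)
            ≈⟨ +-assoc _ _ _ ⟩
          b zero · a (suc j) + (- a zero · b (suc j) + a zero · b (suc j))
            ≈⟨ +-congˡ (trans (sym (distribʳ _ _ _)) (trans (*-congʳ (-‿inverseˡ _)) (zeroˡ _))) ⟩
          b zero · a (suc j) + 0#
            ≈⟨ trans (+-identityʳ _) (*-comm _ _) ⟩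
          a (suc j) · b zero ∎

    -- The induction starts from one vector, because independence of each later vector is tested by
    -- pairing with a vector already present.
    singletonFamily : {U : Subspace n} → ∃[ v ] (Member U v × ¬ v ≋ 0ᴹ) → CompleteFamily U 1
    singletonFamily {U} (v , v∈U , v≉0) = extendFamily (emptyFamily U) v v∈U
      (λ { a e zero → *ₗ-cancel-nonzeroʳ (≋-trans (λ j → sym (+-identityʳ _)) e) v≉0 }) (λ _ _ ())

    -- The bound pays for the last extension, from `k` to `suc k` vectors, where `size` is at most
    -- `k * k`; earlier extensions cost no more.
    completeFamily : (D : ℕ) {U : Subspace n} → Rich D U → ∃[ v ] (Member U v × ¬ v ≋ 0ᴹ) →
      ∀ k → k ℕ.* (k ℕ.+ k ℕ.* k) ℕ.≤ D → CompleteFamily U (suc k)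
    completeFamily D rich nonzero zero    bound = singletonFamily nonzero
    completeFamily D {U} rich nonzero (suc k) bound =
      extendFamily C u u∈U indep good
      where
      C : CompleteFamily U (suc k)
      C = completeFamily D rich nonzero k (ℕₚ.≤-trans
            (ℕₚ.*-mono-≤ (ℕₚ.n≤1+n k) (ℕₚ.+-mono-≤ (ℕₚ.n≤1+n k) (ℕₚ.*-mono-≤ (ℕₚ.n≤1+n k) (ℕₚ.n≤1+n k)))) bound)
      open CompleteFamily C
      choice = independentModulo {U = U} rich {S} ψ separates w independent members
        (ℕₚ.≤-trans (ℕₚ.*-monoʳ-≤ (suc k) (ℕₚ.+-monoʳ-≤ (suc k) size≤k²)) bound)
      u = proj₁ choice
      u∈U = proj₁ (proj₂ choice)
      good = proj₂ (proj₂ choice)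
      -- In a relation a₀ u + x ≋ 0 with x in the span of w, pairing with w₀ gives
      -- a₀ B w₀ u ∈ S.
      indep : LinearlyIndependent (u ∷ w)
      indep a e = λ { zero → a₀≈0 ; (suc i) → independent (tail a) (λ j → begin
          linearCombination (tail a) w j                ≈⟨ +-identityˡ _ ⟨
          0# + linearCombination (tail a) w j           ≈⟨ +-congʳ (trans (*-congʳ a₀≈0) (zeroˡ _)) ⟨
          linearCombination a (u ∷ w) j                 ≈⟨ e j ⟩
          0#                                            ∎) i }
        where
        open SetoidReasoning setoid
        w₀ = linearCombination δ₀ w
        Bw₀u∈S : Member S (head a *ₗ B w₀ u)
        Bw₀u∈S = +-closed⁻ˡ S (values δ₀ (tail a)) (respects S (λ j → begin
          0#                                                        ≈⟨ vanishes (B-right w₀) e j ⟨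
          B w₀ (linearCombination a (u ∷ w)) j                      ≈⟨ +-homo (B-right w₀) (head a *ₗ u) _ j ⟩
          B w₀ (head a *ₗ u) j + B w₀ (linearCombination (tail a) w) j
                                                                    ≈⟨ +-comm _ _ ⟩
          B w₀ (linearCombination (tail a) w) j + B w₀ (head a *ₗ u) j
                                                                    ≈⟨ +-congˡ (*-homo (B-right w₀) (head a) u j) ⟩
          B w₀ (linearCombination (tail a) w) j + head a · B w₀ u j ∎)
          (0-closed S))
        a₀≈0 : head a ≈ 0#
        a₀≈0 = trans (sym (*-identityʳ _)) (good (head a *ₗ δ₀)
          (respects S (λ j → sym (trans (cong (B-left u) (*-homo (combination w) (head a) δ₀) j)
                                        (*-homo (B-left u) (head a) w₀ j))) Bw₀u∈S) zero)

    -- If the section contained a plane of the span, the coefficient vectors of its two basis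
    -- vectors would have vanishing minors, making the basis dependent.
    completeFamily-avoids : {U : Subspace n} (C : CompleteFamily U k) →
      Empty (hyperplaneSection φ ∩ GrIn (span (CompleteFamily.w C)) 2)
    completeFamily-avoids C L ((_ , φ≋0) , ((b , basis) , L⊆span)) =
      1≉0 (independent δ₀ (≋-trans (combination-δ₀ b) (≋-trans (proj₂ x) (vanishes (combination w) a≋0))) zero)
      where
      open IsBasis basis using (members; independent)
      open CompleteFamily C using (w; complete)
      open SetoidReasoning setoid
      x = L⊆span (members zero)
      y = L⊆span (members (suc zero))
      a₁ = proj₁ x
      a₂ = proj₁ y
      minors : ∀ i j → a₁ i · a₂ j ≈ a₁ j · a₂ i
      minors = complete a₁ a₂ (≋-trans (cong (B-left _) (≋-sym (proj₂ x)))
        (≋-trans (cong (B-right _) (≋-sym (proj₂ y))) (φ≋0 _ _ (members zero) (members (suc zero)))))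
      a≋0 : a₁ ≋ 0ᴹ
      -- The relation `a₁ p` times the second basis vector minus `a₂ p` times the first, read at its
      -- second coefficient.
      a≋0 p = independent (- a₂ p ∷ a₁ p ∷ []) (λ j → begin
        - a₂ p · b zero j + (a₁ p · b (suc zero) j + 0#)
          ≈⟨ +-cong (*-congˡ (proj₂ x j)) (trans (+-identityʳ _) (*-congˡ (proj₂ y j))) ⟩
        - a₂ p · linearCombination a₁ w j + a₁ p · linearCombination a₂ w j
          ≈⟨ +-cong (*-homo (combination w) (- a₂ p) a₁ j) (*-homo (combination w) (a₁ p) a₂ j) ⟨
        linearCombination ((- a₂ p) *ₗ a₁) w j + linearCombination (a₁ p *ₗ a₂) w j
          ≈⟨ +-homo (combination w) ((- a₂ p) *ₗ a₁) (a₁ p *ₗ a₂) j ⟨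
        linearCombination ((- a₂ p) *ₗ a₁ +ᴹ a₁ p *ₗ a₂) w j
          ≈⟨ vanishes (combination w) (λ i → begin
               - a₂ p · a₁ i + a₁ p · a₂ i  ≈⟨ +-congˡ (trans (minors p i) (*-comm _ _)) ⟩
               - a₂ p · a₁ i + a₂ p · a₁ i  ≈⟨ distribʳ _ _ _ ⟨
               (- a₂ p + a₂ p) · a₁ i       ≈⟨ trans (*-congʳ (-‿inverseˡ _)) (zeroˡ _) ⟩
               0#                           ∎) j ⟩
        0# ∎) (suc zero)

    -- Isotropic families and the dichotomy.

    -- `U` is where further vectors are sought. `independent` combines linear independence of `w`
    -- with trivial intersection of its span and `U`; `ker⊆U` says that `codim` conditions suffice
    -- to enter `U`.
    record IsotropicFamily (D k : ℕ) : Set (Level.suc (c ⊔ ℓ)) where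
      field
        w           : Vector (V n) k
        U           : Subspace n
        codim       : ℕ
        codim≤      : codim ℕ.≤ k ℕ.* suc D
        Λ           : LinearMap n codim
        ker⊆U       : ∀ v → Λ ⟨$⟩ v ≋ 0ᴹ → Member U v
        independent : ∀ a → Member U (linearCombination a w) → a ≋ 0ᴹ
        orthogonal  : ∀ a u → Member U u → B (linearCombination a w) u ≋ 0ᴹ
        isotropic   : ∀ a b → B (linearCombination a w) (linearCombination b w) ≋ 0ᴹ

    -- A nonzero `v` in `U` whose pairing with `U` is killed by at most `D` conditions extends the
    -- family. If none exists, `U` is rich, and it is nonzero because its codimension is below `n`.
    isotropic⊎rich : ∀ D k → k ℕ.* suc D ℕ.≤ n →
      IsotropicFamily D k ⊎ ∃[ U ] (Rich D U × ∃[ v ] (Member U v × ¬ v ≋ 0ᴹ))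
    isotropic⊎rich D zero _ = inj₁ record
      { w           = λ ()
      ; U           = whole
      ; codim       = 0
      ; codim≤      = z≤n
      ; Λ           = 0ₗ
      ; ker⊆U       = λ _ _ → tt
      ; independent = λ _ _ ()
      ; orthogonal  = λ _ u _ → 0-homo (B-left u)
      ; isotropic   = λ _ _ → 0-homo (B-left _)
      }
    isotropic⊎rich D (suc k) bound with isotropic⊎rich D k (ℕₚ.≤-trans (ℕₚ.m≤n+m _ (suc D)) bound)
    ... | inj₂ r = inj₂ r
    ... | inj₁ I
      with em {Σ[ v ∈ V n ] Member (IsotropicFamily.U I) v × ¬ v ≋ 0ᴹ × Σ[ d ∈ ℕ ] d ℕ.≤ D ×
               Σ[ Λ ∈ LinearMap n d ] (∀ u → Member (IsotropicFamily.U I) u → Λ ⟨$⟩ u ≋ 0ᴹ → B v u ≋ 0ᴹ)}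
    ... | no  none = inj₂ (U , rich , v , ker⊆U v Λv≋0 , v≉0)
      where
      open IsotropicFamily I
      rich : Rich D U
      rich x x∈U x≉0 d Λ d≤D = decidable-stable em λ none′ →
        none (x , x∈U , x≉0 , d , d≤D , Λ , λ u u∈U Λu≋0 →
          decidable-stable (B x u ≋? 0ᴹ) λ Bxu≉0 → none′ (u , u∈U , Λu≋0 , Bxu≉0))
      -- Strict inequality: `codim ≤ k * suc D`, while `n` is at least `suc k * suc D`.
      kernel-vector = nontrivial-kernel Λ
        (ℕₚ.≤-trans (s≤s (ℕₚ.≤-trans codim≤ (ℕₚ.m≤n+m _ D))) bound)
      v = proj₁ kernel-vector
      v≉0 = proj₁ (proj₂ kernel-vector)
      Λv≋0 = proj₂ (proj₂ kernel-vector)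
    ... | yes (v , v∈U , v≉0 , d , d≤D , Λ′ , Λ′⊆v⊥) = inj₁ record
      { w           = v ∷ w
      ; U           = U′
      ; codim       = suc (d ℕ.+ codim)
      ; codim≤      = s≤s (ℕₚ.+-mono-≤ d≤D codim≤)
      ; Λ           = ⟨ coordinate i , ⟨ Λ′ , Λ ⟩ ⟩
      ; ker⊆U       = λ x e → let e′ = ker-⟨⟩ʳ (coordinate i) ⟨ Λ′ , Λ ⟩ {x} e
                                  x∈U = ker⊆U x (ker-⟨⟩ʳ Λ′ Λ e′) in
                      x∈U , lift (Λ′⊆v⊥ x x∈U (ker-⟨⟩ˡ Λ′ Λ e′)) ,
                      lift (ker-⟨⟩ˡ (coordinate i) ⟨ Λ′ , Λ ⟩ {x} e)
      ; independent = independent′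
      ; orthogonal  = λ a u (u∈U , lift Bvu≋0 , _) j → begin
          B (linearCombination a (v ∷ w)) u j
            ≈⟨ +-homo (B-left u) (head a *ₗ v) (linearCombination (tail a) w) j ⟩
          B (head a *ₗ v) u j + B (linearCombination (tail a) w) u j
            ≈⟨ +-cong (trans (*-homo (B-left u) (head a) v j) (trans (*-congˡ (Bvu≋0 j)) (zeroʳ _)))
                      (orthogonal (tail a) u u∈U j) ⟩
          0# + 0#
            ≈⟨ +-identityˡ 0# ⟩
          0# ∎
      ; isotropic   = λ a b j → begin
          B (linearCombination a (v ∷ w)) (linearCombination b (v ∷ w)) j
            ≈⟨ B-expand (head a) (head b) v (linearCombination (tail a) w) (linearCombination (tail b) w) j ⟩
          B (head b *ₗ linearCombination (tail a) w +ᴹ (- head a) *ₗ linearCombination (tail b) w) v j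
            + B (linearCombination (tail a) w) (linearCombination (tail b) w) j
            ≈⟨ +-cong (lower (+-closed (kernel (B-left v))
                        (*ₗ-closed (kernel (B-left v)) (head b) (lift (orthogonal (tail a) v v∈U)))
                        (*ₗ-closed (kernel (B-left v)) (- head a) (lift (orthogonal (tail b) v v∈U)))) j)
                      (isotropic (tail a) (tail b) j) ⟩
          0# + 0#
            ≈⟨ +-identityˡ 0# ⟩
          0# ∎
      }
      where
      open IsotropicFamily I
      open SetoidReasoning setoid
      i = proj₁ (nonzero-coordinate v≉0)
      vᵢ≉0 = proj₂ (nonzero-coordinate v≉0)
      U′ : Subspace n
      -- As `B` is alternating, `v` is orthogonal to itself; the coordinate condition is what
      -- removes `v` from `U′`.
      U′ = U ⊓ (kernel (B-right v) ⊓ kernel (coordinate i))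
      independent′ : ∀ a → Member U′ (linearCombination a (v ∷ w)) → a ≋ 0ᴹ
      independent′ a (x∈U , _ , lift xᵢ≈0) = λ { zero → a₀≈0 ; (suc j) → tail≋0 j }
        where
        tail≋0 : tail a ≋ 0ᴹ
        tail≋0 = independent (tail a) (+-closed⁻ˡ U (*ₗ-closed U (head a) v∈U) x∈U)
        a₀≈0 : head a ≈ 0#
        a₀≈0 = *-cancel-nonzeroʳ (begin
          head a · v i                                      ≈⟨ +-identityʳ _ ⟨
          head a · v i + 0#                                 ≈⟨ +-congˡ (vanishes (combination w) tail≋0 i) ⟨
          head a · v i + linearCombination (tail a) w i     ≈⟨ xᵢ≈0 zero ⟩
          0#                                                ∎) vᵢ≉0

    isotropicFamily-contained : ∀ {D} (I : IsotropicFamily D k) →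
      HasDimension (span (IsotropicFamily.w I)) k × GrIn (span (IsotropicFamily.w I)) 2 ⊆ hyperplaneSection φ
    isotropicFamily-contained I =
      -- A vanishing combination lies in `U`, so `independent` applies.
      span-dimension w (λ a e → independent a (respects U (≋-sym e) (0-closed U))) ,
      λ (dim , L⊆span) → dim , λ v₁ v₂ v₁∈L v₂∈L →
        let a , v₁≋ = L⊆span v₁∈L
            b , v₂≋ = L⊆span v₂∈L in
        ≋-trans (cong (B-left v₂) v₁≋) (≋-trans (cong (B-right _) v₂≋) (isotropic a b))
      where open IsotropicFamily I

open ClassicalLinearAlgebra

-- Numerical bound and conclusion.

-- For `t = suc k` this bounds the cost of a complete family of `t` vectors. The factor `k + k * k`
-- is `suc k * k` by definition.
k²[1+k]<[1+k]⁴ : ∀ k → k * (k ℕ.+ k * k) ℕ.< suc k ^ 4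
k²[1+k]<[1+k]⁴ k = ℕₚ.*-mono-< (ℕₚ.n<1+n k) (ℕₚ.*-monoʳ-< (suc k) (ℕₚ.m≤m*n (suc k) (suc k * 1)))

corollary4p4 : ∀ {c ℓ : Level} → ExcludedMiddle (c ⊔ ℓ) → (F : Field c ℓ) → let open LinearAlgebra F in
    (s t : ℕ) → s ≥ 2 → t ≥ 2 → (m n : ℕ) → n ≥ s * t ^ 4 →
    (φ : AlternatingBilinearMap n m) →
    (∃[ W ] (HasDimension W s × GrIn W 2 ⊆ hyperplaneSection φ))
    ⊎ (∃[ W ] (HasDimension W t × Empty (hyperplaneSection φ ∩ GrIn W 2)))
corollary4p4 em F s (suc k) _ _ m n n≥st⁴ φ
  -- With `D` the predecessor of `t ^ 4`, `suc D` computes to `t ^ 4`, so the hypothesis on `n` is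
  -- the required bound.
  with isotropic⊎rich em F φ (ℕ.pred (suc k ^ 4)) s n≥st⁴
... | inj₁ I = inj₁ (_ , isotropicFamily-contained em F φ I)
... | inj₂ (U , rich , nonzero) =
  inj₂ (_ , span-dimension em F (CompleteFamily.w C) (CompleteFamily.independent C) , completeFamily-avoids em F φ C)
  where C = completeFamily em F φ _ {U} rich nonzero k (ℕ.s≤s⁻¹ (k²[1+k]<[1+k]⁴ k))
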